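{- Let $H=(V_H,E_H)$ be a graph, $S_H\subset V_H$ a stable set in $H$ and $f_H: V_H \to \mathbb{N}$ a function. Suppose: 1. $H$ is $([f_H,k], S_H)$-critical for some $k\geq \max\left (\max_{v\in V_H}f_H(v),\ \max_{v\in S_H}(f_H(v)+1)\right )$. 2. For this $k$, every list assignment $L_H$ of $H$ with lists contained in $\{1,\dots,k\}$ and satisfying the following conditions is feasible: $|L_H(v)|=f_H(v)$ for all $v\in V_H\setminus S_H$, and there is a color $c$ such that $L_H(v)=\{c\}$ for all $v\in S_H$. Let $G=(V,E)$ be a graph (vertex-disjoint from $H$), $f: V \to \mathbb{N}$ and $v_0\in V$ with $\max_{v\in V}f(v)\leq k$ and $f(v_0)\leq k-1$. Let $G'=(V_H\cup V, E')$ be the graph obtained by adding $H$ to $G$ (disjoint union) and linking every vertex of $S_H$ to $v_0$ by an edge, and let $f': V_H\cup V \to \mathbb{N}$ be defined by $f'(v)=f_H(v)+1$ for $v\in S_H$, $f'(v_0)=f(v_0)+1$, $f'(v)=f_H(v)$ for $v\in V_H\setminus S_H$, and $f'(v)=f(v)$ for $v\in V\setminus \{v_0\}$. Then $G'$ is $[f',k]$-choosable if and only if $G$ is $[f,k]$-choosable.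
   Context: All graphs are finite and simple. A stable set is a set of pairwise non-adjacent vertices. For a graph $G=(V,E)$ and $f:V\to\mathbb N$, an $f$-list assignment is an assignment $L$ of lists with $|L(v)|=f(v)$ for all $v\in V$. A list assignment $L$ is feasible if there is a proper coloring $c$ of $G$ with $c(v)\in L(v)$ for all $v$, and infeasible otherwise. For $k\ge\max_v f(v)$, $G$ is $[f,k]$-choosable if every $f$-list assignment with lists contained in $\{1,\dots,k\}$ is feasible. For $V'\subset V$, $G$ is $([f,k],V')$-critical if (a) there is an infeasible $f$-list assignment $L$ with $L(v)\subset\{1,\dots,k\}$ for all $v\in V$ and $\left|\bigcup_{v\in V'}L(v)\right|\leq k-1$, and (b) for every vertex $v\in V'$, if $f(v)$ is replaced by $f(v)+1$ (all other values of $f$ unchanged), then for the resulting function $\hat f$ the graph $G$ is $[\hat f,k]$-choosable. -}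

module Defs where

open import Data.Bool using (if_then_else_)
open import Data.Fin using (Fin)
open import Data.Fin.Properties using (+↔⊎; inj⇒≟)
open import Data.Fin.Subset using (Subset; _∈_; ∣_∣; ⋃)
open import Data.List using (List; map; filter; allFin)
open import Data.Nat using (ℕ; _+_; _<_)
open import Data.Product using (Σ; _×_; _,_; ∃-syntax)
open import Data.Sum using (_⊎_; inj₁; inj₂)
open import Data.Sum.Function.Propositional using (_⊎-↔_)
open import Function.Bundles using (_↔_; Inverse)
open import Function.Properties.Inverse using (↔-sym; ↔-trans; ↔⇒↣)
open import Level using (0ℓ)
open import Relation.Binary using (Rel; Symmetric) renaming (Decidable to Decidable₂)
open import Relation.Binary.PropositionalEquality using (_≡_; _≢_)
open import Relation.Nullary using (¬_; does; _×-dec_)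
open import Relation.Unary using (Pred; Decidable)

record Graph : Set₁ where
  field
    Vertex     : Set
    order      : ℕ
    enum       : Vertex ↔ Fin order
    Adj        : Rel Vertex 0ℓ
    adj?       : Decidable₂ Adj
    adj-sym    : Symmetric Adj
    adj-irrefl : ∀ {v} → ¬ Adj v v

  _≟ᵛ_ : Decidable₂ (_≡_ {A = Vertex})
  _≟ᵛ_ = inj⇒≟ (↔⇒↣ enum)

  vertices : List Vertex
  vertices = map (Inverse.from enum) (allFin order)

open Graph public using (Vertex)

Stable : (G : Graph) → Pred (Vertex G) 0ℓ → Set
Stable G S = ∀ {u v} → S u → S v → ¬ Graph.Adj G u v

-- Fin k stands for the colour set {1,…,k}.
ListAssignment : Graph → ℕ → Set
ListAssignment G k = Vertex G → Subset k

HasSizes : (G : Graph) {k : ℕ} → (Vertex G → ℕ) → ListAssignment G k → Set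
HasSizes G f L = ∀ v → ∣ L v ∣ ≡ f v

Proper : (G : Graph) {k : ℕ} → (Vertex G → Fin k) → Set
Proper G c = ∀ {u v} → Graph.Adj G u v → c u ≢ c v

Feasible : (G : Graph) {k : ℕ} → ListAssignment G k → Set
Feasible G {k} L = ∃[ c ] (Proper G {k} c × (∀ v → c v ∈ L v))

-- [f,k]-choosability; meaningful when f v ≤ k for all v (otherwise vacuously true).
Choosable : (G : Graph) → (Vertex G → ℕ) → ℕ → Set
Choosable G f k = (L : ListAssignment G k) → HasSizes G f L → Feasible G L

increment : (G : Graph) → (Vertex G → ℕ) → Vertex G → (Vertex G → ℕ)
increment G f v u = if does (Graph._≟ᵛ_ G u v) then f u + 1 else f u

unionOver : (G : Graph) {S : Pred (Vertex G) 0ℓ} → Decidable S →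
            {k : ℕ} → ListAssignment G k → Subset k
unionOver G S? L = ⋃ (map L (filter S? (Graph.vertices G)))

-- The bound |⋃ L(v)| ≤ k − 1 is written with _<_, since truncated subtraction
-- would change its meaning at k = 0.
Critical : (G : Graph) → (Vertex G → ℕ) → ℕ →
           (S : Pred (Vertex G) 0ℓ) → Decidable S → Set
Critical G f k S S? =
  (Σ (ListAssignment G k) λ L →
     HasSizes G f L × ¬ Feasible G L × ∣ unionOver G S? L ∣ < k)
  × (∀ v → S v → Choosable G (increment G f v) k)

module _ (H G : Graph) {S : Pred (Vertex H) 0ℓ} (S? : Decidable S)
         (v₀ : Vertex G) where

  private
    module H = Graph H
    module G = Graph G

  LinkAdj : Rel (H.Vertex ⊎ G.Vertex) 0ℓ
  LinkAdj (inj₁ u) (inj₁ v) = H.Adj u v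
  LinkAdj (inj₁ u) (inj₂ v) = S u × v ≡ v₀
  LinkAdj (inj₂ u) (inj₁ v) = S v × u ≡ v₀
  LinkAdj (inj₂ u) (inj₂ v) = G.Adj u v

  linkAdj? : Decidable₂ LinkAdj
  linkAdj? (inj₁ u) (inj₁ v) = H.adj? u v
  linkAdj? (inj₁ u) (inj₂ v) = S? u ×-dec (v G.≟ᵛ v₀)
  linkAdj? (inj₂ u) (inj₁ v) = S? v ×-dec (u G.≟ᵛ v₀)
  linkAdj? (inj₂ u) (inj₂ v) = G.adj? u v

  linkAdj-sym : Symmetric LinkAdj
  linkAdj-sym {inj₁ _} {inj₁ _} e = H.adj-sym e
  linkAdj-sym {inj₁ _} {inj₂ _} e = e
  linkAdj-sym {inj₂ _} {inj₁ _} e = e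
  linkAdj-sym {inj₂ _} {inj₂ _} e = G.adj-sym e

  linkAdj-irrefl : ∀ {v} → ¬ LinkAdj v v
  linkAdj-irrefl {inj₁ _} = H.adj-irrefl
  linkAdj-irrefl {inj₂ _} = G.adj-irrefl

  link : Graph
  link = record
    { Vertex     = H.Vertex ⊎ G.Vertex
    ; order      = H.order + G.order
    ; enum       = ↔-trans (H.enum ⊎-↔ G.enum) (↔-sym +↔⊎)
    ; Adj        = LinkAdj
    ; adj?       = linkAdj?
    ; adj-sym    = λ {u} {v} → linkAdj-sym {u} {v}
    ; adj-irrefl = λ {v} → linkAdj-irrefl {v}
    }

  linkSizes : (H.Vertex → ℕ) → (G.Vertex → ℕ) → (Vertex link → ℕ)
  linkSizes fH f (inj₁ v) = if does (S? v) then fH v + 1 else fH v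
  linkSizes fH f (inj₂ v) = increment G f v₀ v

{-# OPTIONS --safe #-}
-- From an infeasible list assignment of H whose lists on S miss a colour, obtain (after a
-- transposition of colours) one whose lists on S miss a colour b outside the list of v₀. Adding b
-- to the lists on S and at v₀ forces every colouring of the linked graph to avoid b at v₀, because
-- otherwise S would avoid b and H would be coloured from its infeasible lists.
--
-- Conversely, let L be a list assignment of the linked graph, and call a colour common if it lies
-- in all lists of L on S. A non-common colour x can be avoided on S: removing x from the lists on
-- S leaves one of them with an extra colour, and H is critical. A common colour x can be avoided
-- on S if there is another common colour d, by giving d to all of S. Hence it suffices to delete
-- from L(v₀) a common colour, if it has one, and any colour otherwise.
module Submission where

open import Defs
open import Data.Bool using (if_then_else_)
open import Data.Fin using (Fin; zero; suc)
open import Data.Fin.Permutation.Components using (transpose; transpose-inverse)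
open import Data.Fin.Properties using (any?) renaming (_≟_ to _≟ᶠ_)
open import Data.Fin.Subset using (Subset; Side; inside; outside; _∈_; _∉_; _⊆_; ⊥; ⊤; ⋃; Nonempty; ∣_∣; ⁅_⁆)
open import Data.Fin.Subset.Properties using (_∈?_; s⊆s; x∈p∪q⁺; x∈⁅y⁆⇒x≡y; p⊆q⇒∣p∣≤∣q∣; ∣⊥∣≡0; ∣⊤∣≡n; ⊆-min; nonempty?; Empty-unique)
open import Data.List using (List)
import Data.List.Membership.Propositional as List
open import Data.List.Membership.Propositional.Properties using (∈-map⁺; ∈-filter⁺; ∈-allFin)
open import Data.List.Relation.Unary.Any using (here; there)
open import Data.Nat using (ℕ; zero; suc; _+_; _≤_; _<_; s≤s)
open import Data.Nat.Properties using (+-comm; +-cancelˡ-≡; +-cancelʳ-≤; +-cancelʳ-≡; ≤-reflexive; m≤m+n; <⇒≱; module ≤-Reasoning)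
open import Data.Product using (Σ; _×_; _,_; ∃-syntax; proj₁; proj₂)
open import Data.Sum using (inj₁; inj₂; [_,_])
open import Data.Vec using ([]; _∷_; lookup; _[_]≔_)
open import Data.Vec.Properties using (lookup∘update; lookup∘update′; []=⇒lookup; lookup⇒[]=)
open import Function using (_∘_)
open import Function.Bundles using (_⇔_; mk⇔; Inverse)
open import Level using (0ℓ)
open import Relation.Binary.PropositionalEquality using (_≡_; _≢_; refl; sym; trans; cong; subst; module ≡-Reasoning)
open import Relation.Nullary using (¬_; Dec; yes; no; does; contradiction; decidable-stable; _×-dec_; ¬?)
open import Relation.Nullary.Decidable using (dec-true; dec-false; map′)
open import Relation.Unary using (Pred; Decidable)

private
  variable
    n k : ℕ
    A P : Set

if-yes : (d : Dec P) → P → {x y : A} → (if does d then x else y) ≡ x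
if-yes d p rewrite dec-true d p = refl

if-no : (d : Dec P) → ¬ P → {x y : A} → (if does d then x else y) ≡ y
if-no d ¬p rewrite dec-false d ¬p = refl

-- Subsets of a finite set

weight : Side → ℕ
weight inside  = 1
weight outside = 0

-- The weight of the old entry is added on the left rather than subtracted on the right, so that
-- insertion, removal and transposition all follow from one identity in `ℕ`.
∣[]≔∣ : (p : Subset n) (x : Fin n) (s : Side) →
        weight (lookup p x) + ∣ p [ x ]≔ s ∣ ≡ weight s + ∣ p ∣
∣[]≔∣ (inside  ∷ p) zero    inside  = refl
∣[]≔∣ (inside  ∷ p) zero    outside = refl
∣[]≔∣ (outside ∷ p) zero    inside  = refl
∣[]≔∣ (outside ∷ p) zero    outside = refl
∣[]≔∣ (outside ∷ p) (suc x) s       = ∣[]≔∣ p x s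
∣[]≔∣ (inside  ∷ p) (suc x) s
  rewrite +-comm (weight (lookup p x)) (suc ∣ p [ x ]≔ s ∣)
        | +-comm (weight s) (suc ∣ p ∣)
        | +-comm ∣ p [ x ]≔ s ∣ (weight (lookup p x))
        | +-comm ∣ p ∣ (weight s)
        = cong suc (∣[]≔∣ p x s)

∉⇒lookup : {p : Subset n} {x : Fin n} → x ∉ p → lookup p x ≡ outside
∉⇒lookup {p = p} {x} x∉p with lookup p x in eq
... | inside  = contradiction (lookup⇒[]= x p eq) x∉p
... | outside = refl

∣insert∣ : {p : Subset n} {x : Fin n} → x ∉ p → ∣ p [ x ]≔ inside ∣ ≡ ∣ p ∣ + 1
∣insert∣ {p = p} {x} x∉p with ∣[]≔∣ p x inside
... | eq rewrite ∉⇒lookup x∉p = trans eq (+-comm 1 ∣ p ∣)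

∣remove∣-∈ : {p : Subset n} {x : Fin n} → x ∈ p → ∣ p [ x ]≔ outside ∣ + 1 ≡ ∣ p ∣
∣remove∣-∈ {p = p} {x} x∈p with ∣[]≔∣ p x outside
... | eq rewrite []=⇒lookup x∈p = trans (+-comm ∣ p [ x ]≔ outside ∣ 1) eq

∣remove∣-∉ : {p : Subset n} {x : Fin n} → x ∉ p → ∣ p [ x ]≔ outside ∣ ≡ ∣ p ∣
∣remove∣-∉ {p = p} {x} x∉p with ∣[]≔∣ p x outside
... | eq rewrite ∉⇒lookup x∉p = eq

∣p∣≤∣remove∣+1 : (p : Subset n) (x : Fin n) → ∣ p ∣ ≤ ∣ p [ x ]≔ outside ∣ + 1
∣p∣≤∣remove∣+1 p x with x ∈? p
... | yes x∈p = ≤-reflexive (sym (∣remove∣-∈ x∈p))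
... | no  x∉p = subst (_≤ ∣ p [ x ]≔ outside ∣ + 1) (∣remove∣-∉ x∉p) (m≤m+n _ 1)

∈-[]≔⁻ : {p : Subset n} {x y : Fin n} {s : Side} → y ≢ x → y ∈ p [ x ]≔ s → y ∈ p
∈-[]≔⁻ {p = p} {y = y} {s} y≢x y∈ =
  lookup⇒[]= y p (trans (sym (lookup∘update′ y≢x p s)) ([]=⇒lookup y∈))

∈-remove⇒≢ : {p : Subset n} {x y : Fin n} → y ∈ p [ x ]≔ outside → y ≢ x
∈-remove⇒≢ {p = p} {x} y∈ refl
  with trans (sym (lookup∘update x p outside)) ([]=⇒lookup y∈)
... | ()

-- The image of `p` under the transposition of `x` and `y`, written as two updates so that `∣[]≔∣`
-- computes its size.
swap : Fin n → Fin n → Subset n → Subset n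
swap x y p = (p [ x ]≔ lookup p y) [ y ]≔ lookup p x

-- If `x` and `y` coincide, the update writes back the entry already present; hence the two colours
-- of a swap need not be distinct.
lookup-[]≔-lookup : (p : Subset n) (x y : Fin n) → lookup (p [ x ]≔ lookup p y) y ≡ lookup p y
lookup-[]≔-lookup p x y with y ≟ᶠ x
... | yes refl = lookup∘update x p (lookup p x)
... | no  y≢x  = lookup∘update′ y≢x p (lookup p y)

∣swap∣ : (x y : Fin n) (p : Subset n) → ∣ swap x y p ∣ ≡ ∣ p ∣
∣swap∣ x y p = +-cancelˡ-≡ (weight (lookup p y)) _ _ (begin
  weight (lookup p y) + ∣ swap x y p ∣  ≡⟨ cong (λ s → weight s + ∣ swap x y p ∣) (lookup-[]≔-lookup p x y) ⟨
  weight (lookup q y) + ∣ swap x y p ∣  ≡⟨ ∣[]≔∣ q y (lookup p x) ⟩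
  weight (lookup p x) + ∣ q ∣           ≡⟨ ∣[]≔∣ p x (lookup p y) ⟩
  weight (lookup p y) + ∣ p ∣           ∎)
  where
  open ≡-Reasoning
  q = p [ x ]≔ lookup p y

lookup-swap : (x y : Fin n) (p : Subset n) (z : Fin n) →
              lookup (swap x y p) z ≡ lookup p (transpose x y z)
-- The tests follow the order in which `transpose` makes them, so that its value reduces in each
-- branch.
lookup-swap x y p z with z ≟ᶠ x
... | yes refl = lookup-swapˡ
  where
  lookup-swapˡ : lookup (swap x y p) x ≡ lookup p y
  lookup-swapˡ with x ≟ᶠ y
  ... | yes refl = lookup∘update x (p [ x ]≔ lookup p x) (lookup p x)
  ... | no  x≢y  = trans (lookup∘update′ x≢y (p [ x ]≔ lookup p y) (lookup p x)) (lookup∘update x p (lookup p y))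
... | no z≢x with z ≟ᶠ y
...   | yes refl = lookup∘update y (p [ x ]≔ lookup p y) (lookup p x)
...   | no  z≢y  = trans (lookup∘update′ z≢y (p [ x ]≔ lookup p y) (lookup p x)) (lookup∘update′ z≢x p (lookup p y))

∈-swap⁻ : {x y : Fin n} {p : Subset n} {z : Fin n} → z ∈ swap x y p → transpose x y z ∈ p
∈-swap⁻ {x = x} {y} {p} {z} z∈ =
  lookup⇒[]= (transpose x y z) p (trans (sym (lookup-swap x y p z)) ([]=⇒lookup z∈))

-- At `y` the swapped set carries the old entry of `x`; this moves a missing colour to a prescribed
-- place.
∉-swapʳ : {x y : Fin n} {p : Subset n} → x ∉ p → y ∉ swap x y p
∉-swapʳ {x = x} {y} {p} x∉p y∈ = x∉p (lookup⇒[]= x p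
  (trans (sym (lookup∘update y (p [ x ]≔ lookup p y) (lookup p x))) ([]=⇒lookup y∈)))

transpose-injective : (x y : Fin n) {u v : Fin n} → transpose x y u ≡ transpose x y v → u ≡ v
transpose-injective x y eq =
  trans (sym (transpose-inverse y x)) (trans (cong (transpose y x) eq) (transpose-inverse y x))

∃-⊆-of-size : (p : Subset n) (m : ℕ) → m ≤ ∣ p ∣ → ∃[ q ] (q ⊆ p × ∣ q ∣ ≡ m)
∃-⊆-of-size {n} p         zero    _       = ⊥ , ⊆-min p , ∣⊥∣≡0 n
∃-⊆-of-size (inside  ∷ p) (suc m) (s≤s h) with ∃-⊆-of-size p m h
... | q , q⊆p , ∣q∣≡m = inside ∷ q , s⊆s q⊆p , cong suc ∣q∣≡m
∃-⊆-of-size (outside ∷ p) (suc m) h       with ∃-⊆-of-size p (suc m) h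
... | q , q⊆p , ∣q∣≡m = outside ∷ q , s⊆s q⊆p , ∣q∣≡m

∣p∣<n⇒∃∉ : (p : Subset n) → ∣ p ∣ < n → ∃[ x ] x ∉ p
∣p∣<n⇒∃∉ {n} p ∣p∣<n with any? (λ x → ¬? (x ∈? p))
... | yes x∉p  = x∉p
... | no  none = contradiction (subst (_≤ ∣ p ∣) (∣⊤∣≡n n) (p⊆q⇒∣p∣≤∣q∣ ⊤⊆p)) (<⇒≱ ∣p∣<n)
  where
  ⊤⊆p : ⊤ ⊆ p
  ⊤⊆p {x} _ = decidable-stable (x ∈? p) (λ x∉p → none (x , x∉p))

∣p∣≡m+1⇒nonempty : (p : Subset n) {m : ℕ} → ∣ p ∣ ≡ m + 1 → Nonempty p
∣p∣≡m+1⇒nonempty {n} p {m} eq with nonempty? p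
... | yes ne = ne
... | no  ¬ne with trans (sym (∣⊥∣≡0 n)) (trans (sym (cong ∣_∣ (Empty-unique ¬ne))) (trans eq (+-comm m 1)))
...   | ()

∈-⋃ : {x : Fin n} {p : Subset n} {ps : List (Subset n)} → p List.∈ ps → x ∈ p → x ∈ ⋃ ps
∈-⋃ (here refl) x∈p = x∈p∪q⁺ (inj₁ x∈p)
∈-⋃ (there p∈)  x∈p = x∈p∪q⁺ (inj₂ (∈-⋃ p∈ x∈p))

-- List assignments

module _ (G : Graph) where
  open Graph G using (enum; vertices; _≟ᵛ_)

  ∈-vertices : (v : Vertex G) → v List.∈ vertices
  ∈-vertices v = subst (List._∈ vertices) (Inverse.strictlyInverseʳ enum v) (∈-map⁺ _ (∈-allFin (Inverse.to enum v)))

  ∈-unionOver : {S : Pred (Vertex G) 0ℓ} (S? : Decidable S) (L : ListAssignment G k) {v : Vertex G} {x : Fin k} →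
                S v → x ∈ L v → x ∈ unionOver G S? L
  ∈-unionOver S? L Sv = ∈-⋃ (∈-map⁺ L (∈-filter⁺ S? (∈-vertices _) Sv))

  anyVertex? : {Q : Pred (Vertex G) 0ℓ} → Decidable Q → Dec (∃[ v ] Q v)
  anyVertex? {Q} Q? = map′ (λ (i , q) → Inverse.from enum i , q)
    (λ (v , q) → Inverse.to enum v , subst Q (sym (Inverse.strictlyInverseʳ enum v)) q)
    (any? (Q? ∘ Inverse.from enum))

  increment-≡ : (f : Vertex G → ℕ) (v : Vertex G) → increment G f v v ≡ f v + 1
  increment-≡ f v = if-yes (v ≟ᵛ v) refl

  increment-≢ : (f : Vertex G → ℕ) {u v : Vertex G} → u ≢ v → increment G f v u ≡ f u
  increment-≢ f {u} {v} u≢v = if-no (u ≟ᵛ v) u≢v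

  feasible-mono : {L M : ListAssignment G k} → (∀ v → L v ⊆ M v) → Feasible G L → Feasible G M
  feasible-mono L⊆M (c , proper , c∈L) = c , proper , λ v → L⊆M v (c∈L v)

  -- `Choosable` asks for lists of exact size. Longer lists are trimmed first, and a colouring from
  -- the sublists still fits.
  choosable-≥ : {f : Vertex G → ℕ} → Choosable G f k → (L : ListAssignment G k) →
                (∀ v → f v ≤ ∣ L v ∣) → Feasible G L
  choosable-≥ {f = f} choosable L f≤∣L∣ =
    feasible-mono (λ v → proj₁ (proj₂ (trim v))) (choosable (proj₁ ∘ trim) (λ v → proj₂ (proj₂ (trim v))))
    where
    trim : ∀ v → ∃[ q ] (q ⊆ L v × ∣ q ∣ ≡ f v)
    trim v = ∃-⊆-of-size (L v) (f v) (f≤∣L∣ v)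

  -- Renaming colours by a transposition is injective and so keeps a colouring proper.
  feasible-swap⁻ : (x y : Fin k) {L : ListAssignment G k} → Feasible G (swap x y ∘ L) → Feasible G L
  feasible-swap⁻ x y (c , proper , c∈L) =
    transpose x y ∘ c , (λ e eq → proper e (transpose-injective x y eq)) , λ v → ∈-swap⁻ (c∈L v)

  module _ {S : Pred (Vertex G) 0ℓ} (S? : Decidable S) where

    -- Below, `S` is either the linked set in `H` or the single vertex `v₀` of `G`, so one operation
    -- serves both ends of the link.
    updateOn : (Subset k → Subset k) → ListAssignment G k → ListAssignment G k
    updateOn g L v = if does (S? v) then g (L v) else L v

    updateOn-∈ : (g : Subset k → Subset k) (L : ListAssignment G k) {v : Vertex G} → S v → updateOn g L v ≡ g (L v)
    updateOn-∈ g L {v} Sv = if-yes (S? v) Sv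

    updateOn-∉ : (g : Subset k → Subset k) (L : ListAssignment G k) {v : Vertex G} → ¬ S v → updateOn g L v ≡ L v
    updateOn-∉ g L {v} ¬Sv = if-no (S? v) ¬Sv

    insertOn removeOn : Fin k → ListAssignment G k → ListAssignment G k
    insertOn x = updateOn (_[ x ]≔ inside)
    removeOn x = updateOn (_[ x ]≔ outside)

    -- The resulting size function unfolds to `linkSizes` on `H`, and to `increment` when `S` is a
    -- single vertex tested by `_≟ᵛ_`.
    ∣insertOn∣ : {f : Vertex G → ℕ} {x : Fin k} {L : ListAssignment G k} → HasSizes G f L →
                 (∀ v → S v → x ∉ L v) → HasSizes G (λ v → if does (S? v) then f v + 1 else f v) (insertOn x L)
    ∣insertOn∣ {L = L} sizes x∉L v with S? v
    ... | yes Sv = trans (∣insert∣ (x∉L v Sv)) (cong (_+ 1) (sizes v))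
    ... | no  _  = sizes v

    ∈-insertOn⁻ : {x y : Fin k} (L : ListAssignment G k) (v : Vertex G) → (S v → y ≢ x) → y ∈ insertOn x L v → y ∈ L v
    ∈-insertOn⁻ L v y≢x y∈ with S? v
    ... | yes Sv = ∈-[]≔⁻ (y≢x Sv) y∈
    ... | no  _  = y∈

    ∈-removeOn⁻ : {x y : Fin k} (L : ListAssignment G k) (v : Vertex G) → y ∈ removeOn x L v → y ∈ L v
    ∈-removeOn⁻ L v y∈ with S? v
    ... | yes _ = ∈-[]≔⁻ (∈-remove⇒≢ y∈) y∈
    ... | no  _ = y∈

    ∈-removeOn⇒≢ : {x y : Fin k} (L : ListAssignment G k) {v : Vertex G} → S v → y ∈ removeOn x L v → y ≢ x
    ∈-removeOn⇒≢ {x = x} {y} L {v} Sv y∈ = ∈-remove⇒≢ {p = L v} (subst (y ∈_) (updateOn-∈ (_[ x ]≔ outside) L Sv) y∈)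

-- Avoiding a colour on S

module _ (H : Graph) {S : Pred (Vertex H) 0ℓ} (S? : Decidable S) {fH : Vertex H → ℕ} {k : ℕ}
         (L : ListAssignment H k)
         (sizes : HasSizes H (λ v → if does (S? v) then fH v + 1 else fH v) L) where
  open Graph H using (_≟ᵛ_)

  private
    size-∈ : ∀ {v} → S v → ∣ L v ∣ ≡ fH v + 1
    size-∈ {v} Sv = trans (sizes v) (if-yes (S? v) Sv)

    size-∉ : ∀ {v} → ¬ S v → ∣ L v ∣ ≡ fH v
    size-∉ {v} ¬Sv = trans (sizes v) (if-no (S? v) ¬Sv)

  -- The list of `u` loses nothing and keeps `fH u + 1` colours, while any other list on `S` drops
  -- from `fH v + 1` to no less than `fH v`. These sizes suffice for `fH` incremented at `u`.
  feasible-removeOn-∉ : {u : Vertex H} → S u → Choosable H (increment H fH u) k →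
                        {x : Fin k} → x ∉ L u → Feasible H (removeOn H S? x L)
  feasible-removeOn-∉ {u} Su choosable {x} x∉Lu = choosable-≥ H choosable (removeOn H S? x L) large
    where
    open ≤-Reasoning
    large : ∀ v → increment H fH u v ≤ ∣ removeOn H S? x L v ∣
    large v = cases (v ≟ᵛ u) (S? v)
      where
      cases : Dec (v ≡ u) → Dec (S v) → increment H fH u v ≤ ∣ removeOn H S? x L v ∣
      cases (yes refl) _ = begin
        increment H fH u u          ≡⟨ increment-≡ H fH u ⟩
        fH u + 1                    ≡⟨ size-∈ Su ⟨
        ∣ L u ∣                     ≡⟨ ∣remove∣-∉ x∉Lu ⟨
        ∣ L u [ x ]≔ outside ∣      ≡⟨ cong ∣_∣ (updateOn-∈ H S? (_[ x ]≔ outside) L Su) ⟨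
        ∣ removeOn H S? x L u ∣     ∎
      cases (no v≢u) (yes Sv) = begin
        increment H fH u v          ≡⟨ increment-≢ H fH v≢u ⟩
        fH v                        ≤⟨ +-cancelʳ-≤ 1 _ _ (subst (_≤ ∣ L v [ x ]≔ outside ∣ + 1) (size-∈ Sv) (∣p∣≤∣remove∣+1 (L v) x)) ⟩
        ∣ L v [ x ]≔ outside ∣      ≡⟨ cong ∣_∣ (updateOn-∈ H S? (_[ x ]≔ outside) L Sv) ⟨
        ∣ removeOn H S? x L v ∣     ∎
      cases (no v≢u) (no ¬Sv) = begin
        increment H fH u v          ≡⟨ increment-≢ H fH v≢u ⟩
        fH v                        ≡⟨ size-∉ ¬Sv ⟨
        ∣ L v ∣                     ≡⟨ cong ∣_∣ (updateOn-∉ H S? (_[ x ]≔ outside) L ¬Sv) ⟨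
        ∣ removeOn H S? x L v ∣     ∎

  -- Replacing every list on `S` by the singleton of `d` gives a feasible assignment, and `d`
  -- survives the removal of `x`.
  feasible-removeOn-≢ :
    ((M : ListAssignment H k) → (∀ v → ¬ S v → ∣ M v ∣ ≡ fH v) →
      (Σ (Fin k) λ c → ∀ v → S v → M v ≡ ⁅ c ⁆) → Feasible H M) →
    {x d : Fin k} → x ≢ d → (∀ v → S v → d ∈ L v) → Feasible H (removeOn H S? x L)
  feasible-removeOn-≢ singletons {x} {d} x≢d d∈L =
    feasible-mono H M⊆ (singletons M (λ v ¬Sv → trans (cong ∣_∣ (updateOn-∉ H S? (λ _ → ⁅ d ⁆) L ¬Sv)) (size-∉ ¬Sv))
                                     (d , λ v Sv → updateOn-∈ H S? (λ _ → ⁅ d ⁆) L Sv))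
    where
    M : ListAssignment H k
    M = updateOn H S? (λ _ → ⁅ d ⁆) L

    M⊆ : ∀ v → M v ⊆ removeOn H S? x L v
    M⊆ v y∈ with S? v
    ... | no  _  = y∈
    ... | yes Sv with x∈⁅y⁆⇒x≡y d y∈
    ...   | refl = lookup⇒[]= d _ (trans (lookup∘update′ (x≢d ∘ sym) (L v) outside) ([]=⇒lookup (d∈L v Sv)))

-- The linked graph

module _ (H G : Graph) {S : Pred (Vertex H) 0ℓ} (S? : Decidable S) (v₀ : Vertex G) {k : ℕ} where
  open Graph G using (_≟ᵛ_)

  private
    v₀? : Decidable (_≡ v₀)
    v₀? v = v ≟ᵛ v₀

  -- The only edges between `H` and `G` join `S` to `v₀`, so two separate colourings glue once the
  -- one of `H` avoids `c v₀` on `S`.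
  feasible-link : (L : ListAssignment (link H G S? v₀) k) (c : Vertex G → Fin k) → Proper G c →
                  (∀ v → c v ∈ L (inj₂ v)) → Feasible H (removeOn H S? (c v₀) (L ∘ inj₁)) →
                  Feasible (link H G S? v₀) L
  feasible-link L c c-proper c∈L (cH , cH-proper , cH∈) =
    [ cH , c ] , (λ {u} {v} → proper u v) , λ { (inj₁ v) → ∈-removeOn⁻ H S? (L ∘ inj₁) v (cH∈ v) ; (inj₂ v) → c∈L v }
    where
    avoids : ∀ {v} → S v → cH v ≢ c v₀
    avoids {v} Sv = ∈-removeOn⇒≢ H S? (L ∘ inj₁) Sv (cH∈ v)

    proper : ∀ u v → LinkAdj H G S? v₀ u v → [ cH , c ] u ≢ [ cH , c ] v
    proper (inj₁ u) (inj₁ v) e           = cH-proper e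
    proper (inj₁ u) (inj₂ v) (Su , refl) = avoids Su
    proper (inj₂ u) (inj₁ v) (Sv , refl) = avoids Sv ∘ sym
    proper (inj₂ u) (inj₂ v) e           = c-proper e

  link-choosable⁻ : {fH : Vertex H → ℕ} {f : Vertex G → ℕ} →
                    (Σ (ListAssignment H k) λ LH → HasSizes H fH LH × ¬ Feasible H LH × ∣ unionOver H S? LH ∣ < k) →
                    f v₀ < k → Choosable (link H G S? v₀) (linkSizes H G S? v₀ fH f) k → Choosable G f k
  link-choosable⁻ {fH} {f} (LH , sizesH , infeasible , small) fv₀<k choosable L sizes
    -- `a` is missed by all lists of `LH` on `S`, and `b` by the list of `v₀`; swapping them in `LH`
    -- makes `b` missing in both places.
    with ∣p∣<n⇒∃∉ (unionOver H S? LH) small | ∣p∣<n⇒∃∉ (L v₀) (subst (_< k) (sym (sizes v₀)) fv₀<k)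
  ... | a , a∉U | b , b∉Lv₀ = colour (choosable L′ sizes′)
    where
    M : ListAssignment H k
    M = swap a b ∘ LH

    b∉M : ∀ v → S v → b ∉ M v
    b∉M v Sv = ∉-swapʳ (λ a∈ → a∉U (∈-unionOver H S? LH Sv a∈))

    L′ : ListAssignment (link H G S? v₀) k
    L′ (inj₁ v) = insertOn H S? b M v
    L′ (inj₂ v) = insertOn G v₀? b L v

    sizes′ : HasSizes (link H G S? v₀) (linkSizes H G S? v₀ fH f) L′
    sizes′ (inj₁ v) = ∣insertOn∣ H S? (λ u → trans (∣swap∣ a b (LH u)) (sizesH u)) b∉M v
    sizes′ (inj₂ v) = ∣insertOn∣ G v₀? sizes (λ { _ refl → b∉Lv₀ }) v

    colour : Feasible (link H G S? v₀) L′ → Feasible G L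
    colour (c , proper , c∈L′) = c ∘ inj₂ , (λ {u} {v} → proper {inj₂ u} {inj₂ v}) ,
      λ v → ∈-insertOn⁻ G v₀? L v (λ { refl → cv₀≢b }) (c∈L′ (inj₂ v))
      where
      -- If `v₀` had colour `b`, the link edges would keep `b` off `S`, and `c` on `H` would be a
      -- colouring from `M`, hence yield one from `LH`.
      cv₀≢b : c (inj₂ v₀) ≢ b
      cv₀≢b cv₀≡b = infeasible (feasible-swap⁻ H a b
        ( c ∘ inj₁ , (λ {u} {v} → proper {inj₁ u} {inj₁ v})
        , λ v → ∈-insertOn⁻ H S? M v
                  (λ Sv cv≡b → proper {inj₁ v} {inj₂ v₀} (Sv , refl) (trans cv≡b (sym cv₀≡b)))
                  (c∈L′ (inj₁ v))))

  link-choosable⁺ : {fH : Vertex H → ℕ} {f : Vertex G → ℕ} →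
                    (∀ v → S v → Choosable H (increment H fH v) k) →
                    ((M : ListAssignment H k) → (∀ v → ¬ S v → ∣ M v ∣ ≡ fH v) →
                      (Σ (Fin k) λ c → ∀ v → S v → M v ≡ ⁅ c ⁆) → Feasible H M) →
                    Choosable G f k → Choosable (link H G S? v₀) (linkSizes H G S? v₀ fH f) k
  link-choosable⁺ {fH} {f} critical singletons choosable L sizes = extend deletable
    where
    L₀ = L (inj₂ v₀)

    size₀ : ∣ L₀ ∣ ≡ f v₀ + 1
    size₀ = trans (sizes (inj₂ v₀)) (increment-≡ G f v₀)

    -- The complement of being common, stated existentially because its witness is the vertex at
    -- which criticality is applied.
    Omitted : Fin k → Set
    Omitted x = ∃[ v ] (S v × x ∉ L (inj₁ v))

    omitted? : Decidable Omitted
    omitted? x = anyVertex? H (λ v → S? v ×-dec ¬? (x ∈? L (inj₁ v)))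

    ¬omitted⇒common : ∀ {x} → ¬ Omitted x → ∀ v → S v → x ∈ L (inj₁ v)
    ¬omitted⇒common {x} ¬om v Sv = decidable-stable (x ∈? L (inj₁ v)) (λ x∉ → ¬om (v , Sv , x∉))

    -- The last component says that `d` is common as soon as some colour of `L₀` is; if none is, it
    -- holds vacuously for any `d`.
    deletable : ∃[ d ] (d ∈ L₀ × (∀ x → x ∈ L₀ → ¬ Omitted x → ¬ Omitted d))
    deletable with any? (λ x → (x ∈? L₀) ×-dec ¬? (omitted? x))
    ... | yes (d , d∈ , ¬om) = d , d∈ , λ _ _ _ → ¬om
    ... | no  none with ∣p∣≡m+1⇒nonempty L₀ size₀
    ...   | d , d∈ = d , d∈ , λ x x∈ ¬om → contradiction (x , x∈ , ¬om) none

    extend : ∃[ d ] (d ∈ L₀ × (∀ x → x ∈ L₀ → ¬ Omitted x → ¬ Omitted d)) → Feasible (link H G S? v₀) L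
    extend (d , d∈ , common-d) with choosable LG sizesG
      where
      LG : ListAssignment G k
      LG = removeOn G v₀? d (L ∘ inj₂)

      sizesG : HasSizes G f LG
      sizesG v with v ≟ᵛ v₀
      ... | yes refl = trans (cong ∣_∣ (updateOn-∈ G v₀? (_[ d ]≔ outside) (L ∘ inj₂) refl))
                             (+-cancelʳ-≡ 1 _ _ (trans (∣remove∣-∈ {p = L₀} d∈) size₀))
      ... | no v≢v₀  = trans (cong ∣_∣ (updateOn-∉ G v₀? (_[ d ]≔ outside) (L ∘ inj₂) v≢v₀))
                             (trans (sizes (inj₂ v)) (increment-≢ G f v≢v₀))
    ... | c , proper , c∈ = feasible-link L c proper c∈L avoiding
      where
      c∈L : ∀ v → c v ∈ L (inj₂ v)
      c∈L v = ∈-removeOn⁻ G v₀? (L ∘ inj₂) v (c∈ v)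

      avoiding : Feasible H (removeOn H S? (c v₀) (L ∘ inj₁))
      -- If `c v₀` is common then so is `d`, and the two differ because `d` was deleted from the
      -- list of `v₀`; thus `d` can be given to all of `S`.
      avoiding with omitted? (c v₀)
      ... | yes (u , Su , x∉) = feasible-removeOn-∉ H S? (L ∘ inj₁) (sizes ∘ inj₁) Su (critical u Su) x∉
      ... | no  ¬om = feasible-removeOn-≢ H S? (L ∘ inj₁) (sizes ∘ inj₁) singletons
                        (∈-removeOn⇒≢ G v₀? (L ∘ inj₂) refl (c∈ v₀))
                        (¬omitted⇒common (common-d (c v₀) (c∈L v₀) ¬om))

lemma4 : (H : Graph) (S : Pred (Vertex H) 0ℓ) (S? : Decidable S) (fH : Vertex H → ℕ) →
    Stable H S →
    (k : ℕ) →
    (∀ v → fH v ≤ k) →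
    (∀ v → S v → fH v + 1 ≤ k) →
    Critical H fH k S S? →
    ((L : ListAssignment H k) →
    (∀ v → ¬ S v → ∣ L v ∣ ≡ fH v) →
    (Σ (Fin k) λ c → ∀ v → S v → L v ≡ ⁅ c ⁆) →
    Feasible H L) →
    (G : Graph) (f : Vertex G → ℕ) (v₀ : Vertex G) →
    (∀ v → f v ≤ k) →
    f v₀ + 1 ≤ k →
    Choosable (link H G S? v₀) (linkSizes H G S? v₀ fH f) k ⇔ Choosable G f k
-- The two halves of criticality serve opposite directions of the equivalence.
lemma4 H S S? fH _ k _ _ (infeasible , critical) singletons G f v₀ _ fv₀+1≤k =
  mk⇔ (link-choosable⁻ H G S? v₀ infeasible (subst (_≤ k) (+-comm (f v₀) 1) fv₀+1≤k))
      (link-choosable⁺ H G S? v₀ critical singletons)
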